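{- Let $c$ and $b$ be odd integers with $1\leq c\leq 9$ and $3\leq b\leq 9$, and let $u\in U_{[c,b]}$. Then there exist arbitrarily long finite sequences of consecutive $u$-attracted numbers for $S_{[c,b]}$.
   Context: For integers $c\ge 0$, $b\ge 2$, the function $S_{[c,b]}:\mathbb{Z}^+\to\mathbb{Z}^+$ is defined by $S_{[c,b]}(a)=c+\sum_{i=0}^n a_i^2$, where $a=\sum_{i=0}^n a_i b^i$ with integers $0\le a_i\le b-1$ is the base-$b$ expansion of the positive integer $a$. $S_{[c,b]}^k$ denotes the $k$-fold iterate ($S_{[c,b]}^0$ is the identity). $U_{[c,b]}=\{a\in\mathbb{Z}^+ \mid S_{[c,b]}^m(a)=a \text{ for some } m\in\mathbb{Z}^+\}$ is the set of all elements of fixed points and cycles of $S_{[c,b]}$. For $u\in U_{[c,b]}$, a positive integer $a$ is a $u$-attracted number (for $S_{[c,b]}$) if $S_{[c,b]}^k(a)=u$ for some $k\in\mathbb{Z}_{\ge 0}$. "Arbitrarily long" means: for every $N\in\mathbb{Z}^+$ there are $N$ consecutive positive integers all of which are $u$-attracted. -}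

module Defs where

open import Data.Digit using (toDigits)
open import Data.Fin.Base using (toℕ)
open import Data.List.Base using (map)
open import Data.Nat.Base using (ℕ; _+_; _≤_; _<_; _^_; parity)
open import Data.Nat.ListAction using (sum)
open import Data.Nat.Properties using (_≤?_)
open import Data.Parity.Base using (1ℙ)
open import Data.Product.Base using (∃-syntax; _×_; proj₁)
open import Function.Endo.Propositional ℕ using () renaming (_^_ to _^∘_)
open import Relation.Binary.PropositionalEquality.Core using (_≡_)
open import Relation.Nullary.Decidable using (fromWitness)

Odd : ℕ → Set
Odd n = parity n ≡ 1ℙ

-- S_{[c,b]}, as a function on ℕ rather than ℤ⁺. It maps positive numbers to
-- positive numbers; the extra value S_{[c,b]}(0) = c is never used below,
-- since every starting point is required to be positive. The type of toDigits
-- does not exclude leading zeros, but these do not affect the sum of squares.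
S : (c b : ℕ) → 2 ≤ b → ℕ → ℕ
S c b b≥2 a = c + sum (map (λ d → toℕ d ^ 2) (proj₁ (toDigits b {fromWitness b≥2} a)))

U : (c b : ℕ) → 2 ≤ b → ℕ → Set
U c b b≥2 a = 0 < a × ∃[ m ] 0 < m × (S c b b≥2 ^∘ m) a ≡ a

Attracted : (c b : ℕ) → 2 ≤ b → (u a : ℕ) → Set
Attracted c b b≥2 u a = 0 < a × ∃[ k ] (S c b b≥2 ^∘ k) a ≡ u

ArbitrarilyLongRuns : (ℕ → Set) → Set
ArbitrarilyLongRuns P = ∀ N → 0 < N → ∃[ a ] 0 < a × (∀ i → i < N → P (a + i))

{-# OPTIONS --safe #-}
module Submission where

-- Write Q for the sum of the squares of the base-b digits, so S = c + Q.
-- A composite F of S and translations can be lifted: if all F t + n (n > 0)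
-- are u-attracted, then so are all t + n′ for a suitable n′ > 0, because
-- adding b^r R with b^r large increases S by Q R, and Q R can be any number.
-- Two numbers at distance w can be translated to x + b^r and x + w + b^r, so
-- S turns the distance w into ∣Q x - Q (x + w)∣ for an x of our choice. For odd
-- b this preserves the parity of w; x = 0 decreases every large w, and a search
-- over the small w shows that 0 or 1 is always reached. Hence numbers of equal
-- parity can be merged, a finite set collapses to at most two numbers, these
-- become adjacent, and finally c + 1 and c + 2. It remains to find, on every
-- cycle, a number reached from both n and n + 1 for some n ≥ c + 2.

open import Defs
open import Data.Nat.Base using (ℕ; _≤_)
open import Data.Nat.Properties using (<⇒≤)

open import Data.Bool.Base using (Bool; T; if_then_else_; _∨_)
open import Data.Bool.ListAction using (all; any)
open import Data.Bool.Properties using (T-∨)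
open import Data.Digit using (Expansion; fromDigits; toDigits)
open import Data.Fin.Base using (toℕ; fromℕ<)
open import Data.Fin.Properties using (toℕ<n; toℕ-fromℕ<)
open import Data.List.Base using (List; []; _∷_; map; upTo)
open import Data.List.Extrema.Nat using (max; xs≤max)
open import Data.List.Membership.Propositional using (_∈_)
open import Data.List.Membership.Propositional.Properties using (∈-upTo⁺)
open import Data.List.Membership.DecPropositional using (_∈?_)
open import Data.List.Relation.Unary.All as All using (All; []; _∷_)
open import Data.List.Relation.Unary.All.Properties using (all⁺; map⁻)
open import Data.List.Relation.Unary.Any using (here; there)
open import Data.Nat.Base hiding (ℕ; _≤_)
open import Data.Nat.DivMod
open import Data.Nat.Induction using (<-rec)
open import Data.Nat.ListAction using (sum)
open import Data.Nat.Properties hiding (<⇒≤)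
open import Data.Nat.Solver using (module +-*-Solver)
open import Data.Parity.Base as ℙ using (Parity; 0ℙ; 1ℙ)
import Data.Parity.Properties as ℙ
open import Data.Product.Base using (∃-syntax; _×_; _,_; proj₁; proj₂)
open import Data.Sum.Base using (_⊎_; inj₁; inj₂; [_,_]′)
open import Data.Unit.Base using (tt)
open import Function.Base using (_∘_; id)
open import Function.Bundles using (Equivalence)
open import Function.Endo.Propositional ℕ using (^-homo) renaming (_^_ to _^∘_)
open import Relation.Binary.PropositionalEquality
open import Relation.Nullary.Decidable using (True; from-yes; toWitness; _→-dec_)
open import Relation.Nullary.Negation using (contradiction)

-- Iterates, parity and powers

^∘-cong : ∀ {f g : ℕ → ℕ} → f ≗ g → ∀ k → f ^∘ k ≗ g ^∘ k
^∘-cong f≗g zero    a = refl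
^∘-cong {g = g} f≗g (suc k) a = trans (f≗g _) (cong g (^∘-cong f≗g k a))

^∘-+ : ∀ (f : ℕ → ℕ) m n a → (f ^∘ (m + n)) a ≡ (f ^∘ m) ((f ^∘ n) a)
^∘-+ f m n = cong-app (^-homo f m n)

^∘-period : ∀ {f : ℕ → ℕ} {m a} → (f ^∘ m) a ≡ a → ∀ j → (f ^∘ (j * m)) a ≡ a
^∘-period             fᵐa≡a zero    = refl
^∘-period {f} {m} {a} fᵐa≡a (suc j) =
  trans (^∘-+ f m (j * m) a) (trans (cong (f ^∘ m) (^∘-period fᵐa≡a j)) fᵐa≡a)

parity-∣-∣ : ∀ m n → parity ∣ m - n ∣ ≡ parity m ℙ.+ parity n
parity-∣-∣ zero    n       = refl
parity-∣-∣ (suc m) zero    = sym (ℙ.+-identityʳ (parity (suc m)))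
parity-∣-∣ (suc m) (suc n) = begin
  parity ∣ m - n ∣                  ≡⟨ parity-∣-∣ m n ⟩
  parity m ℙ.+ parity n             ≡⟨ ℙ.+-homo-+ m n ⟨
  parity (m + n)                    ≡⟨ cong (parity ∘ suc) (+-suc m n) ⟨
  parity (suc m + suc n)            ≡⟨ ℙ.+-homo-+ (suc m) (suc n) ⟩
  parity (suc m) ℙ.+ parity (suc n) ∎
  where open ≡-Reasoning

-- Lets the exponent be read off from the numbers themselves: `b ^ r` exceeds everything up to `r`.
n<[2+k]^n : ∀ k n → n < (2 + k) ^ n
n<[2+k]^n k zero    = z<s
n<[2+k]^n k (suc n) = ≤-<-trans (n<[2+k]^n k n)
  (^-monoʳ-< (2 + k) (s<s z<s) (n<1+n n))

RunsFor : (b c : ℕ) → Set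
RunsFor b c = ∀ (2≤b : 2 ≤ b) u → U c b 2≤b u → ArbitrarilyLongRuns (Attracted c b 2≤b u)

-- Search along orbits and descent

hits : (ℕ → ℕ) → List ℕ → ℕ → ℕ → Bool
hits f ts zero       a = any (a ≡ᵇ_) ts
hits f ts (suc fuel) a = any (a ≡ᵇ_) ts ∨ hits f ts fuel (f a)

module _ {P : ℕ → Set} where

  any-≡ᵇ-elim : ∀ {ts a} → All P ts → T (any (a ≡ᵇ_) ts) → P a
  any-≡ᵇ-elim {t ∷ ts} {a} (Pt ∷ Pts) h with Equivalence.to (T-∨ {a ≡ᵇ t}) h
  ... | inj₁ a≡t = subst P (sym (≡ᵇ⇒≡ a t a≡t)) Pt
  ... | inj₂ h′  = any-≡ᵇ-elim Pts h′

  hits-elim : ∀ {f ts} → All P ts → (∀ a → P (f a) → P a) →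
              ∀ fuel a → T (hits f ts fuel a) → P a
  hits-elim Pts back zero       a h = any-≡ᵇ-elim Pts h
  hits-elim {f} {ts} Pts back (suc fuel) a h
    with Equivalence.to (T-∨ {any (a ≡ᵇ_) ts}) h
  ... | inj₁ a∈ts = any-≡ᵇ-elim Pts a∈ts
  ... | inj₂ h′   = back a (hits-elim Pts back fuel (f a) h′)

  -- Strong induction: from `L` on, `g` leads to something smaller; below `L`, a finite check
  -- follows the orbit of `f` into `ts`. For distances, `f` uses tabulated shifts while `g` uses
  -- shift 0; for `S′` the two maps agree.
  descend : ∀ {f g : ℕ → ℕ} {L ts fuel} → All P ts →
            (∀ a → P (f a) → P a) → (∀ a → P (g a) → P a) →
            (∀ a → L ≤ a → g a < a) → T (all (hits f ts fuel) (upTo L)) →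
            ∀ a → P a
  descend {f} {g} {L} {ts} {fuel} Pts back-f back-g g< check =
    <-rec P λ a rec → by-cases a rec (<-≤-connex a L)
    where
    by-cases : ∀ a → (∀ {x} → x < a → P x) → a < L ⊎ L ≤ a → P a
    by-cases a rec (inj₁ a<L) = hits-elim Pts back-f fuel a
      (All.lookup (all⁺ (hits f ts fuel) (upTo L) check) (∈-upTo⁺ a<L))
    by-cases a rec (inj₂ L≤a) = back-g a (rec (g< a L≤a))

-- Fuel a suffices for a; this evaluates much faster than toDigits.
sumSq : ∀ b → .⦃ NonZero b ⦄ → (fuel a : ℕ) → ℕ
sumSq b zero       _         = 0
sumSq b (suc fuel) zero      = 0
sumSq b (suc fuel) a@(suc _) = (a % b) ^ 2 + sumSq b fuel (a / b)

findShift : List (ℕ × ℕ) → ℕ → ℕ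
findShift []              w = 0
findShift ((v , x) ∷ vxs) w = if v ≡ᵇ w then x else findShift vxs w

-- Sums of squares of base-`b` digits

module Base (k : ℕ) where

  -- The form `2 + k` makes the base visibly at least 2; `p` is the largest digit.
  b p : ℕ
  b = 2 + k
  p = 1 + k

  Q : ℕ → ℕ
  Q a = sumSq b a a

  squares : Expansion b → ℕ
  squares ds = sum (map (λ d → toℕ d ^ 2) ds)

  -- An expansion of 0 need not be empty, since leading zeros are allowed, but all its digits
  -- vanish.
  squares-zero : ∀ ds → fromDigits ds ≡ 0 → squares ds ≡ 0
  squares-zero []       _  = refl
  squares-zero (d ∷ ds) eq = cong₂ (λ x y → x ^ 2 + y)
    (m+n≡0⇒m≡0 (toℕ d) eq)
    (squares-zero ds (m*n≡0⇒m≡0 (fromDigits ds) b (m+n≡0⇒n≡0 (toℕ d) eq)))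

  sumSq-suc : ∀ fuel a → sumSq b (suc fuel) a ≡ (a % b) ^ 2 + sumSq b fuel (a / b)
  sumSq-suc zero    zero    = refl
  sumSq-suc (suc _) zero    = refl
  sumSq-suc fuel    (suc a) = refl

  module _ {d} (d<b : d < b) (x : ℕ) where

    [d+xb]%b : (d + x * b) % b ≡ d
    [d+xb]%b = trans ([m+kn]%n≡m%n d x b) (m<n⇒m%n≡m d<b)

    [d+xb]/b : (d + x * b) / b ≡ x
    [d+xb]/b = begin
      (d + x * b) / b   ≡⟨ +-distrib-/ d (x * b) (subst (_< b) (sym eq) d<b) ⟩
      d / b + x * b / b ≡⟨ cong₂ _+_ (m<n⇒m/n≡0 d<b) (m*n/n≡m x b) ⟩
      x                 ∎
      where
      open ≡-Reasoning
      eq : d % b + x * b % b ≡ d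
      eq = trans (cong₂ _+_ (m<n⇒m%n≡m d<b) (m*n%n≡0 x b)) (+-identityʳ d)

  sumSq-fromDigits : ∀ fuel ds → fromDigits ds ≤ fuel → sumSq b fuel (fromDigits ds) ≡ squares ds
  sumSq-fromDigits zero       ds       v≤ = sym (squares-zero ds (n≤0⇒n≡0 v≤))
  sumSq-fromDigits (suc fuel) []       v≤ = refl
  sumSq-fromDigits (suc fuel) (d ∷ ds) v≤ = begin
    sumSq b (suc fuel) v                 ≡⟨ sumSq-suc fuel v ⟩
    (v % b) ^ 2 + sumSq b fuel (v / b)   ≡⟨ cong₂ (λ x y → x ^ 2 + sumSq b fuel y)
                                              ([d+xb]%b (toℕ<n d) (fromDigits ds)) ([d+xb]/b (toℕ<n d) (fromDigits ds)) ⟩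
    toℕ d ^ 2 + sumSq b fuel (fromDigits ds)
      ≡⟨ cong (toℕ d ^ 2 +_) (sumSq-fromDigits fuel ds (tail≤ (fromDigits ds) v≤)) ⟩
    squares (d ∷ ds)                     ∎
    where
    open ≡-Reasoning
    v = toℕ d + fromDigits ds * b
    -- One unit of fuel per digit is enough: a positive tail `x` satisfies `x < x * b`.
    tail≤ : ∀ x → toℕ d + x * b ≤ suc fuel → x ≤ fuel
    tail≤ zero      _ = z≤n
    tail≤ x@(suc _) h = s≤s⁻¹ (<-≤-trans (m<m*n x b (s<s z<s)) (m+n≤o⇒n≤o (toℕ d) h))

  digits : ∀ a → ∃[ ds ] fromDigits {b} ds ≡ a
  digits = toDigits b {tt}

  S≗c+Q : ∀ c (2≤b : 2 ≤ b) → S c b 2≤b ≗ λ a → c + Q a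
  S≗c+Q c 2≤b a with digits a
  ... | ds , refl = cong (c +_) (sym (sumSq-fromDigits (fromDigits ds) ds ≤-refl))

  Q-digit : ∀ {d} → d < b → ∀ x → Q (d + x * b) ≡ d ^ 2 + Q x
  Q-digit {d} d<b x with digits x
  ... | ds , refl = begin
    Q (d + fromDigits ds * b)     ≡⟨ cong (λ e → Q (e + fromDigits ds * b)) (toℕ-fromℕ< d<b) ⟨
    Q (fromDigits (fromℕ< d<b ∷ ds)) ≡⟨ sumSq-fromDigits _ (fromℕ< d<b ∷ ds) ≤-refl ⟩
    toℕ (fromℕ< d<b) ^ 2 + squares ds
      ≡⟨ cong₂ (λ e q → e ^ 2 + q) (toℕ-fromℕ< d<b) (sym (sumSq-fromDigits _ ds ≤-refl)) ⟩
    d ^ 2 + Q (fromDigits ds)     ∎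
    where
    open ≡-Reasoning

  digit-induction : (P : ℕ → Set) → P 0 → (∀ {d} → d < b → ∀ x → P x → P (d + x * b)) → ∀ a → P a
  digit-induction P P0 step a = subst P (proj₂ (digits a)) (go (proj₁ (digits a)))
    where
    go : ∀ ds → P (fromDigits ds)
    go []       = P0
    go (d ∷ ds) = step (toℕ<n d) (fromDigits ds) (go ds)

  -- The digits of `x` fill the lowest `r` places and those of `y` the places above. The induction
  -- on `r` peels off the lowest digit of `x`.
  Q-+-^ : ∀ r x y → x < b ^ r → Q (x + b ^ r * y) ≡ Q x + Q y
  Q-+-^ zero    zero y x<  = cong Q (+-identityʳ y)
  Q-+-^ zero    (suc x) y (s<s ())
  Q-+-^ (suc r) x y x<  = begin
    Q (x + b * b ^ r * y)              ≡⟨ cong (λ z → Q (z + b * b ^ r * y)) x≡ ⟩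
    Q (d + x′ * b + b * b ^ r * y)     ≡⟨ cong Q (rearrange d x′ b (b ^ r) y) ⟩
    Q (d + (x′ + b ^ r * y) * b)       ≡⟨ Q-digit d<b (x′ + b ^ r * y) ⟩
    d ^ 2 + Q (x′ + b ^ r * y)         ≡⟨ cong (d ^ 2 +_) (Q-+-^ r x′ y x′<) ⟩
    d ^ 2 + (Q x′ + Q y)               ≡⟨ +-assoc (d ^ 2) (Q x′) (Q y) ⟨
    d ^ 2 + Q x′ + Q y                 ≡⟨ cong (_+ Q y) (Q-digit d<b x′) ⟨
    Q (d + x′ * b) + Q y               ≡⟨ cong (λ z → Q z + Q y) x≡ ⟨
    Q x + Q y                          ∎
    where
    open ≡-Reasoning
    d   = x % b
    x′  = x / b
    d<b = m%n<n x b
    x≡  = m≡m%n+[m/n]*n x b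
    x′< : x′ < b ^ r
    x′< = m<n*o⇒m/o<n {x} {b ^ r} {b} (subst (x <_) (*-comm b (b ^ r)) x<)
    rearrange : ∀ d x′ b B y → d + x′ * b + b * B * y ≡ d + (x′ + B * y) * b
    rearrange = solve 5 (λ d x′ b B y →
      d :+ x′ :* b :+ b :* B :* y := d :+ (x′ :+ B :* y) :* b) refl
      where open +-*-Solver

  d²≤ : ∀ {d} → d < b → d ^ 2 ≤ p * d
  d²≤ {d} d<b = subst (_≤ p * d) (cong (d *_) (sym (*-identityʳ d))) (*-monoˡ-≤ d (s≤s⁻¹ d<b))

  -- Each digit satisfies `d ^ 2 ≤ p * d`, and the digit sum is at most `a`.
  Q≤p*a : ∀ a → Q a ≤ p * a
  Q≤p*a = digit-induction _ z≤n λ {d} d<b x Qx≤ → begin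
    Q (d + x * b)     ≡⟨ Q-digit d<b x ⟩
    d ^ 2 + Q x       ≤⟨ +-mono-≤ (d²≤ d<b) (≤-trans Qx≤ (*-monoʳ-≤ p (m≤m*n x b))) ⟩
    p * d + p * (x * b) ≡⟨ *-distribˡ-+ p d (x * b) ⟨
    p * (d + x * b)   ∎
    where open ≤-Reasoning

  -- From here on the quotient `q = a / b` is at least `10 + p * p`. Here 10 is one more than the
  -- largest `c`, and `p * p` is the most that the last digit contributes.
  bound : ℕ
  bound = (10 + p * p) * b

  c+Q< : ∀ {c} → c ≤ 9 → ∀ a → bound ≤ a → c + Q a < a
  c+Q< {c} c≤9 a L≤a = begin-strict
    c + Q a                  ≡⟨ cong (λ z → c + Q z) a≡ ⟩
    c + Q (d + q * b)        ≡⟨ cong (c +_) (Q-digit d<b q) ⟩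
    c + (d ^ 2 + Q q)        ≤⟨ +-mono-≤ c≤9 (+-mono-≤ (≤-trans (d²≤ d<b) (*-monoʳ-≤ p (s≤s⁻¹ d<b))) (Q≤p*a q)) ⟩
    9 + (p * p + p * q)      <⟨ n<1+n _ ⟩
    -- Since `b = 1 + p`, the product `b * q` unfolds to `q + p * q`.
    10 + p * p + p * q       ≤⟨ +-monoˡ-≤ (p * q) L≤q ⟩
    b * q                    ≡⟨ *-comm b q ⟩
    q * b                    ≤⟨ m≤n+m (q * b) d ⟩
    d + q * b                ≡⟨ a≡ ⟨
    a                        ∎
    where
    open ≤-Reasoning
    d   = a % b
    q   = a / b
    d<b = m%n<n a b
    a≡  = m≡m%n+[m/n]*n a b
    L≤q : 10 + p * p ≤ q
    L≤q = subst (_≤ q) (m*n/n≡m (10 + p * p) b) (/-monoˡ-≤ b L≤a)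

  -- The witness is the number written with `n` digits 1.
  Q-surjective : ∀ n → ∃[ R ] Q R ≡ n
  Q-surjective zero    = 0 , refl
  Q-surjective (suc n) with Q-surjective n
  ... | R , refl = 1 + R * b , Q-digit (s<s z<s) R

  -- A digit and its square have equal parity, and modulo 2 an odd base makes every number congruent
  -- to its digit sum.
  parity-Q : parity b ≡ 1ℙ → ∀ a → parity (Q a) ≡ parity a
  parity-Q odd = digit-induction _ refl λ {d} d<b x IH → begin
    parity (Q (d + x * b))                ≡⟨ cong parity (Q-digit d<b x) ⟩
    parity (d ^ 2 + Q x)                  ≡⟨ ℙ.+-homo-+ (d ^ 2) (Q x) ⟩
    parity (d ^ 2) ℙ.+ parity (Q x)       ≡⟨ cong₂ ℙ._+_ (parity-² d) IH ⟩
    parity d ℙ.+ parity x                 ≡⟨ cong (parity d ℙ.+_) (ℙ.*-identityʳ (parity x)) ⟨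
    parity d ℙ.+ (parity x ℙ.* 1ℙ)          ≡⟨ cong (λ z → parity d ℙ.+ (parity x ℙ.* z)) odd ⟨
    parity d ℙ.+ (parity x ℙ.* parity b)    ≡⟨ cong (parity d ℙ.+_) (ℙ.*-homo-* x b) ⟨
    parity d ℙ.+ parity (x * b)           ≡⟨ ℙ.+-homo-+ d (x * b) ⟨
    parity (d + x * b)                    ∎
    where
    open ≡-Reasoning
    parity-² : ∀ d → parity (d ^ 2) ≡ parity d
    parity-² d = trans (cong (λ e → parity (d * e)) (*-identityʳ d))
      (trans (ℙ.*-homo-* d d) (ℙ.*-idem (parity d)))

  -- The constant `c` cancels in this distance, so one table of shifts per base serves all `c`.
  nextDistance : List (ℕ × ℕ) → ℕ → ℕ
  nextDistance shifts w = ∣ Q x - Q (x + w) ∣ where x = findShift shifts w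

-- Lifting through `S′` and translations

module Dynamics (k c : ℕ) where

  open Base k

  S′ : ℕ → ℕ
  S′ a = c + Q a

  infix 4 _↝_
  _↝_ : ℕ → ℕ → Set
  a ↝ u = ∃[ j ] (S′ ^∘ j) a ≡ u

  ↝-trans : ∀ {x y z} → x ↝ y → y ↝ z → x ↝ z
  ↝-trans {x} (i , refl) (j , refl) = j + i , ^∘-+ S′ j i x

  -- A single `n′` must serve the whole list. Positivity is passed along so that liftings compose
  -- and the final run starts at a positive number.
  Lifting : (ℕ → ℕ) → Set
  Lifting F = ∀ ts n → 0 < n → ∃[ n′ ] 0 < n′ × All (λ t → t + n′ ↝ F t + n) ts

  lift-id : Lifting id
  lift-id ts n 0<n = n , 0<n , All.universal (λ t → 0 , refl) ts

  lift-∘ : ∀ {F G} → Lifting G → Lifting F → Lifting (G ∘ F)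
  lift-∘ {F} liftG liftF ts n 0<n with liftG (map F ts) n 0<n
  -- The offsets are chosen backwards: `n₁` for the outer map `G`, then `n₂` for `F` with `n₁` as
  -- its target.
  ... | n₁ , 0<n₁ , hG with liftF ts n₁ 0<n₁
  ...   | n₂ , 0<n₂ , hF = n₂ , 0<n₂ , All.zipWith (λ (f , g) → ↝-trans f g) (hF , map⁻ hG)

  lift-+ : ∀ m → Lifting (_+ m)
  lift-+ m ts n 0<n = m + n , <-≤-trans 0<n (m≤n+m n m) ,
    All.universal (λ t → 0 , sym (+-assoc t m n)) ts

  -- Adding b^r R, whose digits do not overlap those of t, adds Q R to the value.
  lift-S′ : Lifting S′
  lift-S′ ts n 0<n with Q-surjective n
  ... | zero    , refl = contradiction 0<n (λ ())
  ... | R@(suc _) , refl =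
    b ^ r * R , *-mono-< {0} (m^n>0 b r) z<s , All.map shift (xs≤max 0 ts)
    where
    r = max 0 ts
    shift : ∀ {t} → t ≤ r → t + b ^ r * R ↝ S′ t + Q R
    shift {t} t≤r = 1 ,
      trans (cong (c +_) (Q-+-^ r t R (≤-<-trans t≤r (n<[2+k]^n k r)))) (sym (+-assoc c (Q t) (Q R)))

  -- Only upward translations are available, so `s` is sent to `x + b ^ r` in place of `x`. The new
  -- leading digit 1 adds 1 to both values and leaves their distance unchanged.
  shift-to : ∀ s x w → ∃[ F ] Lifting F × F s ≡ suc (S′ x) × F (s + w) ≡ suc (S′ (x + w))
  shift-to s x w = S′ ∘ (_+ m) , lift-∘ lift-S′ (lift-+ m) , at-s , at-s+w
    where
    open ≡-Reasoning
    r = s + (x + w)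
    r< : r < b ^ r
    r< = n<[2+k]^n k r
    m = x + b ^ r ∸ s
    s+m : s + m ≡ x + b ^ r
    s+m = m+[n∸m]≡n (≤-trans (≤-trans (m≤m+n s (x + w)) (<⇒≤ r<)) (m≤n+m (b ^ r) x))
    S′-+-^ : ∀ y → y ≤ r → S′ (y + b ^ r) ≡ suc (S′ y)
    S′-+-^ y y≤r = begin
      c + Q (y + b ^ r)     ≡⟨ cong (λ z → c + Q (y + z)) (*-identityʳ (b ^ r)) ⟨
      c + Q (y + b ^ r * 1) ≡⟨ cong (c +_) (Q-+-^ r y 1 (≤-<-trans y≤r r<)) ⟩
      c + (Q y + Q 1)       ≡⟨ cong (λ z → c + (Q y + z)) (Q-digit (s<s z<s) 0) ⟩
      c + (Q y + 1)         ≡⟨ +-assoc c (Q y) 1 ⟨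
      c + Q y + 1           ≡⟨ +-comm (c + Q y) 1 ⟩
      suc (c + Q y)         ∎
    x+w≤r : x + w ≤ r
    x+w≤r = m≤n+m (x + w) s
    at-s : S′ (s + m) ≡ suc (S′ x)
    at-s = trans (cong S′ s+m) (S′-+-^ x (≤-trans (m≤m+n x w) x+w≤r))
    at-s+w : S′ (s + w + m) ≡ suc (S′ (x + w))
    at-s+w = trans (cong S′ (begin
      s + w + m     ≡⟨ solve 3 (λ s w m → s :+ w :+ m := s :+ m :+ w) refl s w m ⟩
      s + m + w     ≡⟨ cong (_+ w) s+m ⟩
      x + b ^ r + w ≡⟨ solve 3 (λ s w m → s :+ m :+ w := s :+ w :+ m) refl x w (b ^ r) ⟩
      x + w + b ^ r ∎)) (S′-+-^ (x + w) x+w≤r)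
      where open +-*-Solver

  -- Reduction of distances to 0 or 1

  bit : Parity → ℕ
  bit 0ℙ = 0
  bit 1ℙ = 1

  -- Parity decides between 0 and 1: translations preserve the parity of a distance, and so does
  -- `S′` when `b` is odd.
  Reducible : ℕ → Set
  Reducible w = ∀ s t → ∣ s - t ∣ ≡ w → ∃[ F ] Lifting F × ∣ F s - F t ∣ ≡ bit (parity w)

  reducible-step : parity b ≡ 1ℙ → ∀ x w → Reducible ∣ Q x - Q (x + w) ∣ → Reducible w
  reducible-step odd x w red = λ s t → by-cases s t (≤-total s t)
    where
    open ≡-Reasoning
    w′ = ∣ Q x - Q (x + w) ∣
    parity-w′ : parity w′ ≡ parity w
    parity-w′ = begin
      parity w′                             ≡⟨ parity-∣-∣ (Q x) (Q (x + w)) ⟩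
      parity (Q x) ℙ.+ parity (Q (x + w))   ≡⟨ cong₂ ℙ._+_ (parity-Q odd x) (parity-Q odd (x + w)) ⟩
      parity x ℙ.+ parity (x + w)           ≡⟨ parity-∣-∣ x (x + w) ⟨
      parity ∣ x - x + w ∣                  ≡⟨ cong parity (∣m-m+n∣≡n x w) ⟩
      parity w                              ∎
    reduce : ∀ s → ∃[ F ] Lifting F × ∣ F s - F (s + w) ∣ ≡ bit (parity w)
    reduce s with shift-to s x w
    ... | F , liftF , Fs , Fs+w with red (F s) (F (s + w))
               (trans (cong₂ ∣_-_∣ Fs Fs+w) (∣m+n-m+o∣≡∣n-o∣ c (Q x) (Q (x + w))))
    ...   | G , liftG , eq = G ∘ F , lift-∘ liftG liftF , trans eq (cong bit parity-w′)
    ≡s+w : ∀ {s t} → s ≤ t → ∣ s - t ∣ ≡ w → s + w ≡ t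
    ≡s+w {s} s≤t eq = trans (cong (s +_) (trans (sym eq) (m≤n⇒∣m-n∣≡n∸m s≤t))) (m+[n∸m]≡n s≤t)
    by-cases : ∀ s t → s ≤ t ⊎ t ≤ s → ∣ s - t ∣ ≡ w → ∃[ F ] Lifting F × ∣ F s - F t ∣ ≡ bit (parity w)
    by-cases s t (inj₁ s≤t) eq =
      let F , liftF , h = reduce s
      in F , liftF , trans (cong (λ z → ∣ F s - F z ∣) (sym (≡s+w s≤t eq))) h
    by-cases s t (inj₂ t≤s) eq =
      let F , liftF , h = reduce t
      in F , liftF , (begin
        ∣ F s - F t ∣        ≡⟨ ∣-∣-comm (F s) (F t) ⟩
        ∣ F t - F s ∣        ≡⟨ cong (λ z → ∣ F t - F z ∣) (≡s+w t≤s (trans (∣-∣-comm t s) eq)) ⟨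
        ∣ F t - F (t + w) ∣  ≡⟨ h ⟩
        bit (parity w)       ∎)

  reducible : parity b ≡ 1ℙ → ∀ shifts fuel →
              T (all (hits (nextDistance shifts) (0 ∷ 1 ∷ []) fuel) (upTo bound)) → ∀ w → Reducible w
  reducible odd shifts fuel check = descend {fuel = fuel}
    -- The distances 0 and 1 are already reduced, by the identity.
    ((λ s t eq → id , lift-id , eq) ∷ (λ s t eq → id , lift-id , eq) ∷ [])
    -- With shift 0 the next distance is `Q w`, which is below `w` from `bound` on: the case `c = 0`
    -- of `c+Q<`.
    (λ w → reducible-step odd (findShift shifts w) w) (reducible-step odd 0)
    (c+Q< z≤n) check

  -- Collapsing finite sets

  module _ (red : ∀ w → Reducible w) where

    merge : ∀ s t → parity s ≡ parity t → ∃[ F ] Lifting F × F s ≡ F t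
    merge s t eq with red ∣ s - t ∣ s t refl
    ... | F , liftF , h = F , liftF , ∣m-n∣≡0⇒m≡n (trans h (cong bit (begin
      parity ∣ s - t ∣       ≡⟨ parity-∣-∣ s t ⟩
      parity s ℙ.+ parity t  ≡⟨ cong (ℙ._+ parity t) eq ⟩
      parity t ℙ.+ parity t  ≡⟨ ℙ.p+p≡0ℙ (parity t) ⟩
      0ℙ                     ∎)))
      where open ≡-Reasoning

    pigeonhole : ∀ (x y z : Parity) → x ≡ y ⊎ x ≡ z ⊎ y ≡ z
    pigeonhole 0ℙ 0ℙ z  = inj₁ refl
    pigeonhole 1ℙ 1ℙ z  = inj₁ refl
    pigeonhole 0ℙ 1ℙ 0ℙ = inj₂ (inj₁ refl)
    pigeonhole 0ℙ 1ℙ 1ℙ = inj₂ (inj₂ refl)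
    pigeonhole 1ℙ 0ℙ 0ℙ = inj₂ (inj₂ refl)
    pigeonhole 1ℙ 0ℙ 1ℙ = inj₂ (inj₁ refl)

    -- Of the new value and the two old ones, two share a parity; merging these leaves at most two
    -- values again.
    two-values : ∀ ts → ∃[ F ] Lifting F × ∃[ y ] ∃[ z ] All (λ t → F t ≡ y ⊎ F t ≡ z) ts
    two-values [] = id , lift-id , 0 , 0 , []
    two-values (t ∷ ts) with two-values ts
    ... | F , liftF , y , z , h with pigeonhole (parity (F t)) (parity y) (parity z)
    ...   | inj₁ eq with merge (F t) y eq
    ...     | G , liftG , Gx≡Gy = G ∘ F , lift-∘ liftG liftF , G y , G z ,
                inj₁ Gx≡Gy ∷ All.map [ inj₁ ∘ cong G , inj₂ ∘ cong G ]′ h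
    two-values (t ∷ ts) | F , liftF , y , z , h | inj₂ (inj₁ eq) with merge (F t) z eq
    ...     | G , liftG , Gx≡Gz = G ∘ F , lift-∘ liftG liftF , G y , G z ,
                inj₂ Gx≡Gz ∷ All.map [ inj₁ ∘ cong G , inj₂ ∘ cong G ]′ h
    two-values (t ∷ ts) | F , liftF , y , z , h | inj₂ (inj₂ eq) with merge y z eq
    ...     | G , liftG , Gy≡Gz = G ∘ F , lift-∘ liftG liftF , G (F t) , G y ,
                inj₁ refl ∷ All.map [ inj₂ ∘ cong G , inj₂ ∘ (λ e → trans (cong G e) (sym Gy≡Gz)) ]′ h

    adjacent : ∀ y z → ∣ y - z ∣ ≤ 1 → ∃[ q ] (y ≡ q ⊎ y ≡ suc q) × (z ≡ q ⊎ z ≡ suc q)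
    adjacent zero    zero          _ = 0 , inj₁ refl , inj₁ refl
    adjacent zero    (suc zero)    _ = 0 , inj₁ refl , inj₂ refl
    adjacent (suc zero) zero       _ = 0 , inj₂ refl , inj₁ refl
    adjacent zero (suc (suc _)) (s≤s ())
    adjacent (suc (suc _)) zero (s≤s ())
    adjacent (suc y) (suc z)       h with adjacent y z h
    ... | q , hy , hz = suc q , suc′ hy , suc′ hz
      where
      suc′ : ∀ {x} → x ≡ q ⊎ x ≡ suc q → suc x ≡ suc q ⊎ suc x ≡ suc (suc q)
      suc′ = [ inj₁ ∘ cong suc , inj₂ ∘ cong suc ]′

    collapse : ∀ ts → ∃[ F ] Lifting F × All (λ t → F t ≡ 1 + c ⊎ F t ≡ 2 + c) ts
    collapse ts with two-values ts
    ... | F , liftF , y , z , h with red ∣ y - z ∣ y z refl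
    ... | G , liftG , eq with adjacent (G y) (G z) (subst (_≤ 1) (sym eq) (bit≤1 (parity ∣ y - z ∣)))
      where
      bit≤1 : ∀ x → bit x ≤ 1
      bit≤1 0ℙ = z≤n
      bit≤1 1ℙ = ≤-refl
    -- Shifting `q` and `q + 1` to the places of 0 and 1 gives the values `1 + c + Q 0` and
    -- `1 + c + Q 1`.
    ... | q , hy , hz with shift-to q 0 1
    ... | H , liftH , Hq , Hq+1 =
      H ∘ G ∘ F , lift-∘ liftH (lift-∘ liftG liftF) ,
      All.map [ (λ e → final (subst (λ v → G v ≡ q ⊎ G v ≡ suc q) (sym e) hy))
              , (λ e → final (subst (λ v → G v ≡ q ⊎ G v ≡ suc q) (sym e) hz)) ]′ h
      where
      final : ∀ {v} → v ≡ q ⊎ v ≡ suc q → H v ≡ 1 + c ⊎ H v ≡ 2 + c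
      final (inj₁ refl) = inj₁ (trans Hq (cong suc (+-identityʳ c)))
      final (inj₂ refl) = inj₂ (begin
        H (suc q)     ≡⟨ cong H (+-comm 1 q) ⟩
        H (q + 1)     ≡⟨ Hq+1 ⟩
        suc (c + Q 1) ≡⟨ cong (λ v → suc (c + v)) (Q-digit (s<s z<s) 0) ⟩
        suc (c + 1)   ≡⟨ cong suc (+-comm c 1) ⟩
        2 + c         ∎)
        where open ≡-Reasoning

  -- Cycles reached from adjacent pairs

  PairReaches : ℕ → Set
  PairReaches t = ∃[ n ] 0 < n × 1 + c + n ↝ t × 2 + c + n ↝ t

  ReachesPaired : ℕ → Set
  ReachesPaired a = ∃[ t ] a ↝ t × PairReaches t

  -- Every orbit falls below `bound`, and from there the check leads it into `ts`. For `u` on a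
  -- cycle this gives a suitable `t` on the same cycle.
  all-reachPaired : c ≤ 9 → ∀ {ts} fuel → All PairReaches ts →
                    T (all (hits S′ ts fuel) (upTo bound)) → ∀ a → ReachesPaired a
  all-reachPaired c≤9 fuel hts check =
    descend {fuel = fuel} (All.map (λ {t} h → t , (0 , refl) , h) hts) back back (c+Q< c≤9) check
    where
    back : ∀ a → ReachesPaired (S′ a) → ReachesPaired a
    back a (t , r , h) = t , ↝-trans (1 , refl) r , h

  -- Going round `j` times takes `j * m` steps, at least the `j` already made; the remaining ones
  -- lead from `t` back to `u`.
  ↝-back : ∀ {u t m} → 0 < m → (S′ ^∘ m) u ≡ u → u ↝ t → t ↝ u
  ↝-back {u} {m = m} 0<m per (j , refl) = j * m ∸ j , (begin
    (S′ ^∘ (j * m ∸ j)) ((S′ ^∘ j) u) ≡⟨ ^∘-+ S′ (j * m ∸ j) j u ⟨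
    (S′ ^∘ (j * m ∸ j + j)) u         ≡⟨ cong (λ i → (S′ ^∘ i) u) (m∸n+n≡m (m≤m*n j m ⦃ >-nonZero 0<m ⦄)) ⟩
    (S′ ^∘ (j * m)) u                 ≡⟨ ^∘-period per j ⟩
    u                                 ∎)
    where open ≡-Reasoning

  runs : {c≤9 : True (c ≤? 9)} → (∀ w → Reducible w) → ∀ {ts} → All PairReaches ts →
         ∀ fuel → T (all (hits S′ ts fuel) (upTo bound)) → RunsFor b c
  runs {c≤9} red hts fuel check 2≤b u (_ , m , 0<m , per) N _ =
    a , 0<a , λ i i<N → <-≤-trans 0<a (m≤m+n a i) ,
      toS (subst (_↝ u) (+-comm i a) (i+a↝u (∈-upTo⁺ i<N)))
    where
    paired = all-reachPaired (toWitness c≤9) fuel hts check u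
    t    = proj₁ paired
    u↝t  = proj₁ (proj₂ paired)
    pair = proj₂ (proj₂ paired)
    n    = proj₁ pair
    collapsed = collapse red (upTo N)
    -- Each `i + a` with `i < N` reaches `1 + c + n` or `2 + c + n`, hence `t`, and then `u`.
    lifted = proj₁ (proj₂ collapsed) (upTo N) n (proj₁ (proj₂ pair))
    a    = proj₁ lifted
    0<a  = proj₁ (proj₂ lifted)
    t↝u : t ↝ u
    t↝u = ↝-back 0<m (trans (sym (^∘-cong (S≗c+Q c 2≤b) m u)) per) u↝t
    toS : ∀ {x} → x ↝ u → ∃[ j ] (S c b 2≤b ^∘ j) x ≡ u
    toS {x} (j , eq) = j , trans (^∘-cong (S≗c+Q c 2≤b) j x) eq
    land : ∀ {v} → v ≡ 1 + c ⊎ v ≡ 2 + c → v + n ↝ t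
    land (inj₁ refl) = proj₁ (proj₂ (proj₂ pair))
    land (inj₂ refl) = proj₂ (proj₂ (proj₂ pair))
    i+a↝u : ∀ {i} → i ∈ upTo N → i + a ↝ u
    i+a↝u i∈ = ↝-trans (All.lookup (proj₂ (proj₂ lifted)) i∈)
      (↝-trans (land (All.lookup (proj₂ (proj₂ collapsed)) i∈)) t↝u)

-- Finite checks for the bases 3, 5, 7 and 9

odds : List ℕ
odds = 1 ∷ 3 ∷ 5 ∷ 7 ∷ 9 ∷ []

odd≤9⇒∈odds : ∀ {n} → Odd n → n ≤ 9 → n ∈ odds
odd≤9⇒∈odds {n} odd n≤9 = All.lookup
  (from-yes (All.all? (λ n → (parity n ℙ.≟ 1ℙ) →-dec (_∈?_ _≟_ n odds)) (upTo 10)))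
  (∈-upTo⁺ (s≤s n≤9)) odd

-- The pairs (w , x) were found by search. All other w use x = 0, which alone
-- would run into cycles of Q other than 0 and 1.
reducible-3 : ∀ {c} w → Dynamics.Reducible 1 c w
reducible-3 = Dynamics.reducible 1 _ refl
  ((2 , 1) ∷ (5 , 1) ∷ (8 , 1) ∷ []) 20 tt

-- The list in braces has one element of each cycle; the n and the step counts
-- of the entries (n , _ , (i , _) , (j , _)) come from a search.
runs-3 : All (RunsFor 3) odds
runs-3 =
  Dynamics.runs 1 1 reducible-3 {5 ∷ []}
    ((1 , z<s , (2 , refl) , (3 , refl)) ∷ []) 20 tt ∷
  Dynamics.runs 1 3 reducible-3 {8 ∷ []}
    ((1 , z<s , (1 , refl) , (2 , refl)) ∷ []) 20 tt ∷
  Dynamics.runs 1 5 reducible-3 {7 ∷ 6 ∷ 8 ∷ []}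
    ((4 , z<s , (1 , refl) , (2 , refl)) ∷
     (47 , z<s , (3 , refl) , (2 , refl)) ∷
     (1109 , z<s , (3 , refl) , (2 , refl)) ∷ []) 20 tt ∷
  Dynamics.runs 1 7 reducible-3 {8 ∷ []}
    ((1 , z<s , (1 , refl) , (2 , refl)) ∷ []) 20 tt ∷
  Dynamics.runs 1 9 reducible-3 {14 ∷ []}
    ((1 , z<s , (1 , refl) , (2 , refl)) ∷ []) 20 tt ∷
  []

reducible-5 : ∀ {c} w → Dynamics.Reducible 3 c w
reducible-5 = Dynamics.reducible 3 _ refl
  ((4 , 1) ∷ (13 , 1) ∷ (18 , 1) ∷ []) 20 tt

runs-5 : All (RunsFor 5) odds
runs-5 =
  Dynamics.runs 3 1 reducible-5 {2 ∷ []}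
    ((1 , z<s , (3 , refl) , (10 , refl)) ∷ []) 20 tt ∷
  Dynamics.runs 3 3 reducible-5 {13 ∷ []}
    ((1 , z<s , (4 , refl) , (5 , refl)) ∷ []) 20 tt ∷
  Dynamics.runs 3 5 reducible-5 {6 ∷ []}
    ((1 , z<s , (5 , refl) , (4 , refl)) ∷ []) 20 tt ∷
  Dynamics.runs 3 7 reducible-5 {13 ∷ []}
    ((1 , z<s , (8 , refl) , (9 , refl)) ∷ []) 20 tt ∷
  Dynamics.runs 3 9 reducible-5 {11 ∷ []}
    ((1 , z<s , (0 , refl) , (5 , refl)) ∷ []) 20 tt ∷
  []

reducible-7 : ∀ {c} w → Dynamics.Reducible 5 c w
reducible-7 = Dynamics.reducible 5 _ refl
  ((13 , 2) ∷ (45 , 5) ∷ (25 , 1) ∷ (26 , 5) ∷ (16 , 1) ∷ (10 , 1) ∷ (32 , 1) ∷ []) 20 tt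

runs-7 : All (RunsFor 7) odds
runs-7 =
  Dynamics.runs 5 1 reducible-7 {26 ∷ 10 ∷ []}
    ((2 , z<s , (4 , refl) , (1 , refl)) ∷
     (6 , z<s , (2 , refl) , (5 , refl)) ∷ []) 20 tt ∷
  Dynamics.runs 5 3 reducible-7 {20 ∷ 19 ∷ []}
    ((6 , z<s , (4 , refl) , (1 , refl)) ∷
     (3 , z<s , (2 , refl) , (3 , refl)) ∷ []) 20 tt ∷
  Dynamics.runs 5 5 reducible-7 {25 ∷ 6 ∷ 10 ∷ []}
    ((11 , z<s , (2 , refl) , (1 , refl)) ∷
     (1 , z<s , (1 , refl) , (2 , refl)) ∷
     (3 , z<s , (1 , refl) , (0 , refl)) ∷ []) 20 tt ∷
  Dynamics.runs 5 7 reducible-7 {20 ∷ []}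
    ((1 , z<s , (7 , refl) , (2 , refl)) ∷ []) 20 tt ∷
  Dynamics.runs 5 9 reducible-7 {34 ∷ []}
    ((1 , z<s , (7 , refl) , (2 , refl)) ∷ []) 20 tt ∷
  []

reducible-9 : ∀ {c} w → Dynamics.Reducible 7 c w
reducible-9 = Dynamics.reducible 7 _ refl
  ((89 , 1) ∷ (16 , 2) ∷ (68 , 1) ∷ (50 , 2) ∷ (41 , 1) ∷ []) 20 tt

runs-9 : All (RunsFor 9) odds
runs-9 =
  Dynamics.runs 7 1 reducible-9 {3 ∷ []}
    ((1 , z<s , (0 , refl) , (7 , refl)) ∷ []) 20 tt ∷
  Dynamics.runs 7 3 reducible-9 {4 ∷ []}
    ((1 , z<s , (11 , refl) , (12 , refl)) ∷ []) 20 tt ∷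
  Dynamics.runs 7 5 reducible-9 {23 ∷ 42 ∷ 26 ∷ 80 ∷ []}
    ((1 , z<s , (6 , refl) , (9 , refl)) ∷
     (6 , z<s , (2 , refl) , (7 , refl)) ∷
     (67 , z<s , (3 , refl) , (4 , refl)) ∷
     -- The pair is 66878 and 66879, in base 9 written 111658 and 111660. They map to 133 and 80,
     -- which form a cycle of length 2.
     (66872 , z<s , (2 , refl) , (1 , refl)) ∷ []) 20 tt ∷
  Dynamics.runs 7 7 reducible-9 {23 ∷ 8 ∷ 41 ∷ 44 ∷ []}
    ((15 , z<s , (0 , refl) , (3 , refl)) ∷
     (1 , z<s , (1 , refl) , (2 , refl)) ∷
     (23 , z<s , (2 , refl) , (1 , refl)) ∷
     (12 , z<s , (2 , refl) , (3 , refl)) ∷ []) 20 tt ∷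
  Dynamics.runs 7 9 reducible-9 {11 ∷ 22 ∷ []}
    ((1 , z<s , (0 , refl) , (5 , refl)) ∷
     (11 , z<s , (1 , refl) , (0 , refl)) ∷ []) 20 tt ∷
  []

theorem4p1 : ∀ (c b : ℕ) → Odd c → Odd b → 1 ≤ c → c ≤ 9 → (3≤b : 3 ≤ b) → b ≤ 9 →
    ∀ (u : ℕ) → U c b (<⇒≤ 3≤b) u →
    ArbitrarilyLongRuns (Attracted c b (<⇒≤ 3≤b) u)
theorem4p1 c b odd-c odd-b _ c≤9 3≤b b≤9 = cases (odd≤9⇒∈odds odd-b b≤9) 3≤b (<⇒≤ 3≤b)
  where
  c∈odds : c ∈ odds
  c∈odds = odd≤9⇒∈odds odd-c c≤9
  cases : b ∈ odds → 3 ≤ b → RunsFor b c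
  cases (here refl)                                 (s≤s ())
  cases (there (here refl))                         _ = All.lookup runs-3 c∈odds
  cases (there (there (here refl)))                 _ = All.lookup runs-5 c∈odds
  cases (there (there (there (here refl))))         _ = All.lookup runs-7 c∈odds
  cases (there (there (there (there (here refl))))) _ = All.lookup runs-9 c∈odds
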